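{- For all integers $k \ge 0$ it holds that $S'_2(k) = 2 \cdot a_2(k)$.
   Context: The sequence $S'_2 : \mathbb{N}_0 \to \mathbb{N}_0$ (with $\mathbb{N}_0 = \{0,1,2,\dots\}$) is defined recursively: $S'_2(0) := 0$, $S'_2(1) := 2$, and for $k \ge 2$, $S'_2(k) := 2 \cdot (k-i+1)$ for the minimal $i \in \{1,\dots,k-1\}$ with $k-i+1 \le S'_2(i)$ (such an $i$ always exists). The sequence $a_2 : \mathbb{N}_0 \to \mathbb{N}_0$ is defined by $a_2(0) = 0$, $a_2(1) = 1$, and for $k \ge 2$ by the nested recursion $a_2(k) = a_2(k - a_2(k-1)) + a_2(k - 1 - a_2(k-2))$. -}

module Defs where

open import Data.Bool.Base using (if_then_else_)
open import Data.Nat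
open import Data.Nat.Properties
open import Data.Product using (∃-syntax; _×_; _,_; proj₁; proj₂)
open import Data.Sum using (_⊎_; inj₁; inj₂)
open import Relation.Nullary using (¬_; yes; no)
open import Relation.Nullary.Decidable using (⌊_⌋)
open import Relation.Binary.PropositionalEquality

-- Course-of-values recursion: `step n h` computes the n-th term from a table h
-- which is correct at all indices below n.  The table reads 0 at indices ≥ n;
-- `S'₂-rec` and `a₂-rec` show that these entries never matter.

history : (ℕ → (ℕ → ℕ) → ℕ) → ℕ → (ℕ → ℕ)
history step zero    j = 0
history step (suc n) j =
  if ⌊ j ≟ n ⌋ then step n (history step n) else history step n j

courseOfValues : (ℕ → (ℕ → ℕ) → ℕ) → ℕ → ℕ
courseOfValues step n = step n (history step n)

history-< : ∀ step n j → j < n → history step n j ≡ courseOfValues step j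
history-< step (suc n) j j<1+n with j ≟ n
... | yes refl = refl
... | no  j≢n  = history-< step n j (≤∧≢⇒< (s≤s⁻¹ j<1+n) j≢n)

-- The least i' in {i, …, i + n} with k ∸ i' + 1 ≤ h i', provided that the last
-- candidate i + n satisfies this inequality (it is returned untested).  For k ≥ 2
-- and i + n = k - 1 it always does: k ∸ (k - 1) + 1 = 2 ≤ S'₂ (k - 1).
leastFrom : (k : ℕ) (h : ℕ → ℕ) (i n : ℕ) → ℕ
leastFrom k h i zero    = i
leastFrom k h i (suc n) =
  if ⌊ k ∸ i + 1 ≤? h i ⌋ then i else leastFrom k h (suc i) n

S'₂-step : ℕ → (ℕ → ℕ) → ℕ
S'₂-step 0               h = 0
S'₂-step 1               h = 2
S'₂-step k@(suc (suc m)) h = 2 * (k ∸ leastFrom k h 1 m + 1)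

S'₂ : ℕ → ℕ
S'₂ = courseOfValues S'₂-step

a₂-step : ℕ → (ℕ → ℕ) → ℕ
a₂-step 0               h = 0
a₂-step 1               h = 1
a₂-step k@(suc (suc _)) h = h (k ∸ h (k ∸ 1)) + h (k ∸ 1 ∸ h (k ∸ 2))

a₂ : ℕ → ℕ
a₂ = courseOfValues a₂-step

record IsMinimalIndex (f : ℕ → ℕ) (k i : ℕ) : Set where
  field
    1≤i     : 1 ≤ i
    i≤k∸1   : i ≤ k ∸ 1
    holds   : k ∸ i + 1 ≤ f i
    minimal : ∀ j → 1 ≤ j → j < i → ¬ (k ∸ j + 1 ≤ f j)

private
  leastFrom-spec : ∀ k h i n → k ∸ (i + n) + 1 ≤ h (i + n) →
    (∀ j → 1 ≤ j → j < i → ¬ (k ∸ j + 1 ≤ h j)) →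
    let r = leastFrom k h i n in
    i ≤ r × r ≤ i + n × (k ∸ r + 1 ≤ h r) ×
    (∀ j → 1 ≤ j → j < r → ¬ (k ∸ j + 1 ≤ h j))
  leastFrom-spec k h i zero last below rewrite +-identityʳ i =
    ≤-refl , ≤-refl , last , below
  leastFrom-spec k h i (suc n) last below with k ∸ i + 1 ≤? h i
  ... | yes p = ≤-refl , m≤m+n i (suc n) , p , below
  ... | no ¬p rewrite +-suc i n
      with leastFrom-spec k h (suc i) n last below′
    where
    below′ : ∀ j → 1 ≤ j → j < suc i → ¬ (k ∸ j + 1 ≤ h j)
    below′ j 1≤j j<1+i with j ≟ i
    ... | yes refl = ¬p
    ... | no  j≢i  = below j 1≤j (≤∧≢⇒< (s≤s⁻¹ j<1+i) j≢i)
  ...   | lo , hi , ok , min = ≤-trans (n≤1+n i) lo , hi , ok , min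

  S'₂-≥2 : ∀ m → 2 ≤ S'₂ (suc m)
  S'₂-≥2 zero    = ≤-refl
  S'₂-≥2 (suc m) = *-monoʳ-≤ 2 (m≤n+m 1 (k ∸ leastFrom k (history S'₂-step k) 1 m))
    where k = suc (suc m)

S'₂-rec : ∀ k → 2 ≤ k →
  ∃[ i ] IsMinimalIndex S'₂ k i × S'₂ k ≡ 2 * (k ∸ i + 1)
S'₂-rec 1 (s≤s ())
S'₂-rec k@(suc (suc m)) _ = i , spec , refl
  where
  h = history S'₂-step k
  i = leastFrom k h 1 m
  eq : ∀ {j} → j ≤ suc m → h j ≡ S'₂ j
  eq {j} j≤ = history-< S'₂-step k j (s≤s j≤)
  last : k ∸ suc m + 1 ≤ h (suc m)
  last = subst₂ _≤_ (cong (_+ 1) (sym (m+n∸n≡m 1 (suc m)))) (sym (eq ≤-refl)) (S'₂-≥2 m)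
  found = leastFrom-spec k h 1 m last λ j 1≤j j<1 _ → <⇒≱ j<1 1≤j
  i≤ : i ≤ suc m
  i≤ = proj₁ (proj₂ found)
  spec : IsMinimalIndex S'₂ k i
  spec = record
    { 1≤i     = proj₁ found
    ; i≤k∸1   = i≤
    ; holds   = subst (k ∸ i + 1 ≤_) (eq i≤) (proj₁ (proj₂ (proj₂ found)))
    ; minimal = λ j 1≤j j<i p → proj₂ (proj₂ (proj₂ found)) j 1≤j j<i
                  (subst (k ∸ j + 1 ≤_) (sym (eq (≤-trans (<⇒≤ j<i) i≤))) p)
    }

private
  ∸-pos< : ∀ m {x} → 1 ≤ x → suc m ∸ x ≤ m
  ∸-pos< m {suc x} _ = m∸n≤m m x

  rec-at : ∀ k → 1 ≤ a₂ (suc k) →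
    a₂ (2 + k) ≡ a₂ (2 + k ∸ a₂ (1 + k)) + a₂ (1 + k ∸ a₂ k)
  rec-at k pos = cong₂ _+_
    (trans (cong (λ x → h (2 + k ∸ x)) (eq (1 + k) ≤-refl))
           (eq _ (∸-pos< (1 + k) pos)))
    (trans (cong (λ x → h (1 + k ∸ x)) (eq k (n≤1+n k)))
           (eq _ (m∸n≤m (1 + k) (a₂ k))))
    where
    h = history a₂-step (2 + k)
    eq : ∀ j → j ≤ 1 + k → h j ≡ a₂ j
    eq j j≤ = history-< a₂-step (2 + k) j (s≤s j≤)

  module SlowGrowth (a : ℕ → ℕ) (a0 : a 0 ≡ 0) (a1 : a 1 ≡ 1) (a2 : a 2 ≡ 2) (a3 : a 3 ≡ 2)
    (rec-at : ∀ k → 1 ≤ a (suc k) → a (2 + k) ≡ a (2 + k ∸ a (1 + k)) + a (1 + k ∸ a k))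
    where

    Slow : ℕ → Set
    Slow j = a (suc j) ≡ a j ⊎ a (suc j) ≡ suc (a j)

    SlowBelow : ℕ → Set
    SlowBelow n = ∀ j → j < n → Slow j

    slow⇒≤ : ∀ {j} → Slow j → a j ≤ a (suc j)
    slow⇒≤ (inj₁ e) = ≤-reflexive (sym e)
    slow⇒≤ (inj₂ e) = ≤-trans (n≤1+n _) (≤-reflexive (sym e))

    slow⇒bounded : ∀ n → SlowBelow n → ∀ j → j ≤ n → a j ≤ j
    slow⇒bounded n s zero    _   = ≤-reflexive a0
    slow⇒bounded n s (suc j) j<n with s j j<n
    ... | inj₁ e = ≤-trans (≤-reflexive e) (m≤n⇒m≤1+n (slow⇒bounded n s j (<⇒≤ j<n)))
    ... | inj₂ e = ≤-trans (≤-reflexive e) (s≤s (slow⇒bounded n s j (<⇒≤ j<n)))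

    slow⇒positive : ∀ n → SlowBelow n → ∀ j → suc j ≤ n → 1 ≤ a (suc j)
    slow⇒positive n s zero    _   = ≤-reflexive (sym a1)
    slow⇒positive n s (suc j) j<n =
      ≤-trans (slow⇒positive n s j (<⇒≤ j<n)) (slow⇒≤ (s (suc j) j<n))

    u : ℕ → ℕ
    u j = suc j ∸ a j

    u-step : ∀ j → a j ≤ j → Slow j →
      (a (suc j) ≡ a j × u (suc j) ≡ suc (u j)) ⊎ u (suc j) ≡ u j
    u-step j b (inj₁ e) = inj₁ (e , trans (cong (2 + j ∸_) e) (+-∸-assoc 1 (m≤n⇒m≤1+n b)))
    u-step j b (inj₂ e) = inj₂ (cong (2 + j ∸_) e)

    slow-next : ∀ n → SlowBelow n → Slow n
    slow-next 0 s = inj₂ (trans a1 (cong suc (sym a0)))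
    slow-next 1 s = inj₂ (trans a2 (cong suc (sym a1)))
    slow-next 2 s = inj₁ (trans a3 (sym a2))
    slow-next n@(suc (suc (suc m))) s = conclude jump
      where
      pos : ∀ j → j ≤ 2 + m → 1 ≤ a (suc j)
      pos j j≤ = slow⇒positive n s j (s≤s j≤)
      rec : ∀ j → j ≤ 2 + m → a (2 + j) ≡ a (u (1 + j)) + a (u j)
      rec j j≤ = rec-at j (pos j j≤)
      ustep : ∀ j → j ≤ 2 + m →
        (a (suc j) ≡ a j × u (suc j) ≡ suc (u j)) ⊎ u (suc j) ≡ u j
      ustep j j≤ = u-step j (slow⇒bounded n s j (m≤n⇒m≤1+n j≤)) (s j (s≤s j≤))
      m≤2+m : m ≤ 2 + m
      m≤2+m = m≤n+m m 2
      slow-u₁ : Slow (u (1 + m))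
      slow-u₁ = s _ (s≤s (m≤n⇒m≤1+n (∸-pos< (1 + m) (pos m m≤2+m))))
      slow-u₂ : Slow (u (2 + m))
      slow-u₂ = s _ (s≤s (∸-pos< (2 + m) (pos (1 + m) (n≤1+n _))))
      u₀≤u₁ : a (u m) ≤ a (u (1 + m))
      u₀≤u₁ with ustep m m≤2+m
      ... | inj₂ e       = ≤-reflexive (cong a (sym e))
      ... | inj₁ (_ , e) = ≤-trans (slow⇒≤ (s (u m) (s≤s (≤-trans (m∸n≤m (1 + m) (a m)) (n≤1+n _)))))
                                   (≤-reflexive (cong a (sym e)))
      Jump : ℕ → ℕ → Set
      Jump x y = x ≡ y ⊎ x ≡ suc y
      jump : Jump (a (u (3 + m))) (a (u (1 + m)))
      jump with ustep (2 + m) ≤-refl | ustep (1 + m) (n≤1+n _)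
      ... | inj₂ e       | inj₂ e′       = inj₁ (cong a (trans e e′))
      ... | inj₂ e       | inj₁ (_ , e′) = subst (λ x → Jump (a x) (a (u (1 + m)))) (sym (trans e e′)) slow-u₁
      ... | inj₁ (_ , e) | inj₂ e′       =
        subst (λ x → Jump (a x) (a (u (1 + m)))) (sym (trans e (cong suc e′))) slow-u₁
      ... | inj₁ (d , e) | inj₁ (_ , e′) =
        subst₂ (λ x y → Jump (a x) y) (sym e) flat slow-u₂
        where
        u₂≡u₀ : a (u (2 + m)) ≡ a (u m)
        u₂≡u₀ = +-cancelʳ-≡ (a (u (1 + m))) _ _
          (trans (sym (rec (1 + m) (n≤1+n _)))
          (trans d (trans (rec m m≤2+m) (+-comm (a (u (1 + m))) _))))
        flat : a (u (2 + m)) ≡ a (u (1 + m))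
        flat = ≤-antisym (≤-trans (≤-reflexive u₂≡u₀) u₀≤u₁)
          (≤-trans (slow⇒≤ slow-u₁) (≤-reflexive (cong a (sym e′))))
      conclude : Jump (a (u (3 + m))) (a (u (1 + m))) → Slow n
      conclude (inj₁ e) = inj₁ (trans (rec (2 + m) ≤-refl) (trans (cong (_+ a (u (2 + m))) e)
        (trans (+-comm (a (u (1 + m))) _) (sym (rec (1 + m) (n≤1+n _))))))
      conclude (inj₂ e) = inj₂ (trans (rec (2 + m) ≤-refl) (trans (cong (_+ a (u (2 + m))) e)
        (cong suc (trans (+-comm (a (u (1 + m))) _) (sym (rec (1 + m) (n≤1+n _)))))))

    slowBelow : ∀ n → SlowBelow n
    slowBelow (suc n) j j<1+n with j ≟ n
    ... | yes refl = slow-next n (slowBelow n)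
    ... | no  j≢n  = slowBelow n j (≤∧≢⇒< (s≤s⁻¹ j<1+n) j≢n)

  open SlowGrowth a₂ refl refl refl refl rec-at

a₂-slow : ∀ k → a₂ (suc k) ≡ a₂ k ⊎ a₂ (suc k) ≡ suc (a₂ k)
a₂-slow k = slowBelow (suc k) k ≤-refl

-- Hence the truncated subtractions in `a₂-rec` are genuine subtractions.
a₂≤ : ∀ k → a₂ k ≤ k
a₂≤ k = slow⇒bounded k (slowBelow k) k ≤-refl

a₂-positive : ∀ k → 1 ≤ a₂ (suc k)
a₂-positive k = slow⇒positive (suc k) (slowBelow (suc k)) k ≤-refl

a₂-rec : ∀ k → 2 ≤ k → a₂ k ≡ a₂ (k ∸ a₂ (k ∸ 1)) + a₂ (k ∸ 1 ∸ a₂ (k ∸ 2))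
a₂-rec 1 (s≤s ())
a₂-rec (suc (suc k)) _ = rec-at k (a₂-positive k)

{-# OPTIONS --safe #-}
-- Write a for a₂ and u k = k + 1 - a k, so that the recursion reads
-- a k = a (u (k - 1)) + a (u (k - 2)).  As a grows by 0 or 1 per step, so does u,
-- and this yields 2 a (u k - 1) ≤ a k ≤ 2 a (u k).  If S'₂ = 2 a below k, these two
-- inequalities say that u k is the minimal index i with k - i + 1 ≤ S'₂ i, whence
-- S'₂ k = 2 (k - u k + 1) = 2 a k.
module Submission where

open import Data.Nat using (ℕ; _*_; zero; suc; _+_; _∸_; _≤_; _<_; z≤n; s≤s; s≤s⁻¹)
open import Data.Nat.Induction using (<-rec)
open import Data.Nat.Properties
open import Data.Product using (_,_)
open import Data.Sum using (_⊎_; inj₁; inj₂)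
open import Relation.Binary.PropositionalEquality using (_≡_; refl; sym; trans; cong; subst)
open import Relation.Nullary using (contradiction)
open import Defs

step-mono⇒mono : (f : ℕ → ℕ) → (∀ n → f n ≤ f (suc n)) → ∀ {m n} → m ≤ n → f m ≤ f n
step-mono⇒mono f step {n = zero}  z≤n = ≤-refl
step-mono⇒mono f step {m} {suc n} m≤1+n with m≤n⇒m<n∨m≡n m≤1+n
... | inj₁ m<1+n = ≤-trans (step-mono⇒mono f step (s≤s⁻¹ m<1+n)) (step n)
... | inj₂ refl  = ≤-refl

m≤o⇒n≤o⇒m+n≤2*o : ∀ {m n o} → m ≤ o → n ≤ o → m + n ≤ 2 * o
m≤o⇒n≤o⇒m+n≤2*o {o = o} m≤o n≤o rewrite +-identityʳ o = +-mono-≤ m≤o n≤o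

o≤m⇒o≤n⇒2*o≤m+n : ∀ {m n o} → o ≤ m → o ≤ n → 2 * o ≤ m + n
o≤m⇒o≤n⇒2*o≤m+n {o = o} o≤m o≤n rewrite +-identityʳ o = +-mono-≤ o≤m o≤n

-- The argument is carried out for a variable a because a₂ itself unfolds on suc
-- and would defeat rewriting.
module NestedRecursion (a : ℕ → ℕ) (a0 : a 0 ≡ 0) (a1 : a 1 ≡ 1) (a2 : a 2 ≡ 2)
  (slow : ∀ k → a (suc k) ≡ a k ⊎ a (suc k) ≡ suc (a k))
  (a≤ : ∀ k → a k ≤ k)
  (rec : ∀ k → 2 ≤ k → a k ≡ a (k ∸ a (k ∸ 1)) + a (k ∸ 1 ∸ a (k ∸ 2)))
  where

  a-mono : ∀ {m n} → m ≤ n → a m ≤ a n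
  a-mono = step-mono⇒mono a step
    where
    step : ∀ n → a n ≤ a (suc n)
    step n with slow n
    ... | inj₁ e = ≤-reflexive (sym e)
    ... | inj₂ e = ≤-trans (n≤1+n _) (≤-reflexive (sym e))

  u : ℕ → ℕ
  u k = suc k ∸ a k

  u≡1+k∸a : ∀ k → u k ≡ suc (k ∸ a k)
  u≡1+k∸a k = +-∸-assoc 1 (a≤ k)

  u-step : ∀ k → u k ≤ u (suc k)
  u-step k with slow k
  ... | inj₁ e rewrite e = ∸-monoˡ-≤ (a k) (n≤1+n (suc k))
  ... | inj₂ e rewrite e = ≤-refl

  rec-u : ∀ m → a (2 + m) ≡ a (u (1 + m)) + a (u m)
  rec-u m = rec (2 + m) (s≤s (s≤s z≤n))

  -- For `k ≥ 2` both summands of the recursion are values of `a` at earlier values of `u`, which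
  -- are at most `u k`.
  a≤2*a[u] : ∀ k → a k ≤ 2 * a (u k)
  a≤2*a[u] 0 rewrite a0 = z≤n
  -- The first rewrite turns `u 1` into 1, which exposes a new `a 1` for the second.
  a≤2*a[u] 1 rewrite a1 | a1 = s≤s z≤n
  a≤2*a[u] (suc (suc m)) = ≤-trans (≤-reflexive (rec-u m)) (
    m≤o⇒n≤o⇒m+n≤2*o (a-mono (u-step (1 + m)))
                    (a-mono (≤-trans (u-step m) (u-step (1 + m)))))

  -- For `m ≥ 1` the recursions of the two equal values share the summand `a (u m)`. Cancelling it
  -- leaves `a (u (1 + m)) ≡ a (u (m ∸ 1))`, and monotonicity finishes.
  flat⇒a[u]≤a[u] : ∀ m → a (2 + m) ≡ a (1 + m) → a (u (1 + m)) ≤ a (u m)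
  flat⇒a[u]≤a[u] zero    e = contradiction (trans (sym a2) (trans e a1)) λ ()
  flat⇒a[u]≤a[u] (suc m) e = ≤-trans (≤-reflexive skip) (a-mono (u-step m))
    where
    skip : a (u (2 + m)) ≡ a (u m)
    skip = +-cancelʳ-≡ (a (u (1 + m))) _ _
      (trans (sym (rec-u (1 + m)))
      (trans e (trans (rec-u m) (+-comm (a (u (1 + m))) _))))

  -- The argument `k ∸ a k` is `u k - 1`. After a flat step it equals `u (k - 1)`, the argument of
  -- the first summand, and the previous lemma bounds the second. After a growing step it is
  -- `u (k - 1) - 1`, which is at most `u (k - 2)`, so monotonicity bounds both.
  2*a[k∸a]≤a : ∀ k → 2 * a (k ∸ a k) ≤ a k
  2*a[k∸a]≤a 0 rewrite a0 | a0 = z≤n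
  2*a[k∸a]≤a 1 rewrite a1 | a0 = z≤n
  2*a[k∸a]≤a (suc (suc m)) =
    ≤-trans (bound (slow (1 + m))) (≤-reflexive (sym (rec-u m)))
    where
    d≤u : suc m ∸ a (suc m) ≤ u m
    d≤u with slow m
    ... | inj₁ e rewrite e = ≤-refl
    ... | inj₂ e rewrite e = ∸-monoˡ-≤ (a m) (n≤1+n m)
    bound : a (2 + m) ≡ a (1 + m) ⊎ a (2 + m) ≡ suc (a (1 + m)) →
      2 * a (2 + m ∸ a (2 + m)) ≤ a (u (1 + m)) + a (u m)
    bound (inj₁ e) = subst (λ x → 2 * a (2 + m ∸ x) ≤ a (u (1 + m)) + a (u m)) (sym e)
      (o≤m⇒o≤n⇒2*o≤m+n ≤-refl (flat⇒a[u]≤a[u] m e))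
    bound (inj₂ e) = subst (λ x → 2 * a (2 + m ∸ x) ≤ a (u (1 + m)) + a (u m)) (sym e)
      (o≤m⇒o≤n⇒2*o≤m+n (a-mono (∸-monoˡ-≤ (a (1 + m)) (n≤1+n (1 + m)))) (a-mono d≤u))

  k∸u+1≡a : ∀ k → 1 ≤ a k → k ∸ u k + 1 ≡ a k
  k∸u+1≡a k pos = trans (+-comm _ 1) (trans (sym (+-∸-assoc 1 u≤k))
    (m∸[m∸n]≡n (m≤n⇒m≤1+n (a≤ k))))
    where
    -- Positivity of `a k` ensures that `k ∸ u k` does not truncate.
    u≤k : u k ≤ k
    u≤k = ∸-monoʳ-≤ (suc k) pos

  minimalIndex≡u : ∀ s k → 1 ≤ a k → (∀ {j} → j < k → s j ≡ 2 * a j) →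
    ∀ {i} → i < k → IsMinimalIndex s k i → i ≡ u k
  minimalIndex≡u s k pos ih {i} i<k min = ≤-antisym (≮⇒≥ u≮i) (≮⇒≥ i≮u)
    where
    open IsMinimalIndex min
    -- Otherwise `u k` would be a smaller index passing the test, by the upper bound on `a k`.
    u≮i : u k < i → _
    u≮i u<i = minimal (u k) (subst (1 ≤_) (sym (u≡1+k∸a k)) (s≤s z≤n)) u<i
      (subst (k ∸ u k + 1 ≤_) (sym (ih (<-trans u<i i<k)))
        (≤-trans (≤-reflexive (k∸u+1≡a k pos)) (a≤2*a[u] k)))
    -- An index below `u k` is at most `k ∸ a k`; the `+ 1` in the test then makes the chain from
    -- `a k` to itself strict.
    i≮u : i < u k → _
    i≮u i<u = contradiction (begin-strict
        a k               ≡⟨ m∸[m∸n]≡n (a≤ k) ⟨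
        k ∸ (k ∸ a k)     ≤⟨ ∸-monoʳ-≤ k i≤ ⟩
        k ∸ i             <⟨ m<m+n (k ∸ i) (s≤s z≤n) ⟩
        k ∸ i + 1         ≤⟨ holds ⟩
        s i               ≡⟨ ih i<k ⟩
        2 * a i           ≤⟨ *-monoʳ-≤ 2 (a-mono i≤) ⟩
        2 * a (k ∸ a k)   ≤⟨ 2*a[k∸a]≤a k ⟩
        a k               ∎) (<-irrefl refl)
      where
      open ≤-Reasoning
      i≤ : i ≤ k ∸ a k
      i≤ = s≤s⁻¹ (subst (i <_) (u≡1+k∸a k) i<u)

open NestedRecursion a₂ refl refl refl a₂-slow a₂≤ a₂-rec

corollary4p16 : (k : ℕ) → S'₂ k ≡ 2 * a₂ k
corollary4p16 = <-rec _ step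
  where
  step : ∀ k → (∀ {j} → j < k → S'₂ j ≡ 2 * a₂ j) → S'₂ k ≡ 2 * a₂ k
  step 0 ih = refl
  step 1 ih = refl
  step k@(suc (suc m)) ih with S'₂-rec k (s≤s (s≤s z≤n))
  ... | i , min , e = trans e (cong (2 *_)
    (trans (cong (λ x → k ∸ x + 1) (minimalIndex≡u S'₂ k pos ih (s≤s i≤k∸1) min)) (k∸u+1≡a k pos)))
    where
    open IsMinimalIndex min
    pos : 1 ≤ a₂ k
    pos = a₂-positive (suc m)
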